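{- For every $n\ge 1$, $$|\mathrm{Sym}_n(\xi)|=\sum_{t=0}^{n-1} t!\,(t+1)^{n-t-1}.$$
   Context: $\mathrm{Sym}_n$ is the set of permutations $\pi=\pi_1\cdots\pi_n$ of $\{1,\dots,n\}$ in one-line notation. $\xi=(132,\{0,2\},\emptyset)$ is a bivincular pattern: $\pi$ contains $\xi$ if there is an index $j\ge 2$ with $j+1\le n$ such that $\pi_1<\pi_{j+1}<\pi_j$ (that is, $\pi_1\pi_j\pi_{j+1}$ is an occurrence of $132$ starting at the first entry of $\pi$ and whose last two entries are adjacent in position); otherwise $\pi$ avoids $\xi$. $\mathrm{Sym}_n(\xi)$ is the set of permutations in $\mathrm{Sym}_n$ that avoid $\xi$. -}

module Defs where

open import Data.Fin.Base using (Fin; toℕ; _<_)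
open import Data.Fin.Permutation using (Permutation′; _⟨$⟩ʳ_; _≈_)
open import Data.Nat.Base using (ℕ; suc)
open import Data.Product.Base using (Σ; _×_; ∃-syntax; proj₁)
open import Function.Base using (_on_)
open import Function.Bundles using (Inverse)
open import Level using (Level; 0ℓ; _⊔_)
open import Relation.Binary.Bundles using (Setoid)
open import Relation.Binary.PropositionalEquality
  using (_≡_; refl; sym; trans; setoid)
open import Relation.Nullary.Negation.Core using (¬_)

-- Positions and values are numbered from 0, so π ⟨$⟩ʳ i is the one-line
-- entry π_{i+1} lowered by one; the first entry sits at position 0.

-- ξ = (132, {0,2}, ∅): i is the first position (0 in the second component),
-- and the second and third letters are adjacent in position (2 in it).
Containsξ : ∀ {n} → Permutation′ n → Set
Containsξ {n} π =
  ∃[ i ] ∃[ j ] ∃[ k ]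
    ( toℕ {n} i ≡ 0
    × i < j
    × toℕ {n} k ≡ suc (toℕ j)
    × π ⟨$⟩ʳ i < π ⟨$⟩ʳ k
    × π ⟨$⟩ʳ k < π ⟨$⟩ʳ j )

Avoidsξ : ∀ {n} → Permutation′ n → Set
Avoidsξ π = ¬ Containsξ π

-- Two elements are equal when they are the same permutation pointwise;
-- neither the stored inverse nor the avoidance proof is compared.
Symξ : ℕ → Setoid 0ℓ 0ℓ
Symξ n = record
  { Carrier       = Σ (Permutation′ n) Avoidsξ
  ; _≈_           = _≈_ on proj₁
  ; isEquivalence = record
    { refl  = λ _ → refl
    ; sym   = λ p i → sym (p i)
    ; trans = λ p q i → trans (p i) (q i)
    }
  }

HasCardinality : ∀ {c ℓ : Level} → Setoid c ℓ → ℕ → Set (c ⊔ ℓ)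
HasCardinality S N = Inverse S (setoid (Fin N))

{-# OPTIONS --safe #-}
module Submission where

-- Let a be the first entry, with values numbered from 0. A permutation avoids ξ
-- exactly when no entry above a is directly followed by a smaller entry above a,
-- so the maximum, unless it is the first entry, is followed by an entry at most a
-- or ends the word. Reading the word cyclically, so that the last entry is followed
-- by the first entry a, deleting the maximum therefore loses one of a + 1 possible
-- successors and nothing else. Repeating this down to permutations of a + 1 letters
-- starting with their maximum a, of which there are a!, gives a! (a+1)^(n-a-1).

open import Defs
open import Data.List.Base using (map; upTo)
open import Data.Nat.Base using (ℕ; _+_; _*_; _∸_; _^_; _≥_; _!)
open import Data.Nat.ListAction using (sum)

open import Data.Fin.Base
  using (Fin; zero; suc; toℕ; fromℕ; fromℕ<; inject₁; inject≤; punchIn; punchOut)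
open import Data.Fin.Permutation
  using (Permutation; Permutation′; _⟨$⟩ʳ_; _⟨$⟩ˡ_; _≈_; inverseʳ; remove; insert;
         punchIn-permute; remove-insert)
import Data.Fin.Permutation as Perm
open import Data.Fin.Properties
  using (_≟_; toℕ-injective; toℕ-fromℕ; toℕ-fromℕ<; toℕ-inject≤; toℕ<n; toℕ≤pred[n];
         inject₁-injective; fromℕ≢inject₁; suc-injective; punchIn-injective;
         punchIn-punchOut; *↔×; +↔⊎)
open import Data.Fin.Relation.Unary.Top using (view; ‵fromℕ; ‵inject₁)
open import Data.List.Base using (applyUpTo)
open import Data.List.Properties using (map-upTo)
open import Data.Nat.Base using (suc; zero; _≤_; _<_; z≤n; s≤s)
open import Data.Nat.Properties
  using (≤-refl; ≤-reflexive; ≤-trans; ≮⇒≥; ≤⇒≯; <⇒≱; <⇒≤; <⇒≢; m≤n+m; m∸n+n≡m;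
         ∸-+-assoc; +-comm; *-assoc; *-comm; *-identityʳ)
  renaming (suc-injective to ℕ-suc-injective)
open import Data.Product.Base using (Σ; ∃-syntax; _,_; proj₁; proj₂)
open import Data.Product.Function.NonDependent.Setoid using (_×-inverse_)
open import Data.Product.Relation.Binary.Pointwise.NonDependent using (_×ₛ_; Pointwise-≡↔≡)
open import Data.Sum.Base as Sum using (_⊎_; inj₁; inj₂)
open import Data.Sum.Function.Propositional using (_⊎-↔_)
open import Function.Base using (_∘_; _on_)
open import Function.Bundles using (Inverse; Injection; _↔_; mk↔ₛ′)
open import Function.Construct.Identity using (↔-id)
open import Function.Properties.Inverse using (↔⇒↣; ↔-sym; ↔-trans)
import Function.Properties.Inverse as Inv
open import Level using (Level; 0ℓ)
open import Relation.Binary.Bundles using (Setoid)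
open import Relation.Binary.PropositionalEquality
  using (_≡_; _≢_; refl; sym; trans; cong; cong₂; subst; subst₂; setoid; module ≡-Reasoning)
open import Relation.Nullary.Decidable using (yes; no)
open import Relation.Nullary.Negation using (contradiction)

-- Cardinalities of setoids, products and fibred unions.

private
  variable
    c ℓ c′ ℓ′ : Level
    m n : ℕ

-- Surjectivity supplies a chosen preimage of each `y`; the choice respects equality because `f`
-- reflects it.
bijective⇒inverse : (S : Setoid c ℓ) (T : Setoid c′ ℓ′) →
  let module S = Setoid S; module T = Setoid T in
  (f : S.Carrier → T.Carrier) →
  (∀ {x y} → x S.≈ y → f x T.≈ f y) →
  (∀ {x y} → f x T.≈ f y → x S.≈ y) →
  (∀ y → ∃[ x ] f x T.≈ y) →
  Inverse S T
bijective⇒inverse S T f f-cong f-injective f-surjective = record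
  { to        = f
  ; from      = g
  ; to-cong   = f-cong
  ; from-cong = λ {x} {y} x≈y →
      f-injective (T.trans (f∘g x) (T.trans x≈y (T.sym (f∘g y))))
  ; inverse   = (λ {x} y≈gx → T.trans (f-cong y≈gx) (f∘g x))
              , (λ {x} {y} y≈fx → f-injective (T.trans (f∘g y) y≈fx))
  }
  where
  module T = Setoid T
  g = proj₁ ∘ f-surjective
  f∘g : ∀ y → f (g y) T.≈ y
  f∘g = proj₂ ∘ f-surjective

card-× : {S : Setoid c ℓ} {T : Setoid c′ ℓ′} → HasCardinality S m → HasCardinality T n →
         HasCardinality (S ×ₛ T) (m * n)
card-× I J = Inv.trans (I ×-inverse J) (Inv.trans Pointwise-≡↔≡ (↔-sym *↔×))

Σ-Fin↔⊎ : {B : Fin (suc n) → Set} → Σ (Fin (suc n)) B ↔ (B zero ⊎ Σ (Fin n) (B ∘ suc))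
Σ-Fin↔⊎ = mk↔ₛ′
  (λ { (zero , b) → inj₁ b ; (suc i , b) → inj₂ (i , b) })
  (λ { (inj₁ b) → zero , b ; (inj₂ (i , b)) → suc i , b })
  (λ { (inj₁ b) → refl ; (inj₂ (i , b)) → refl })
  (λ { (zero , b) → refl ; (suc i , b) → refl })

-- Peeling off index `zero` leaves the same problem for `f ∘ suc`, which is how `applyUpTo`
-- recurses.
Σ-Fin↔sum-applyUpTo : ∀ (f : ℕ → ℕ) n →
                      Σ (Fin n) (Fin ∘ f ∘ toℕ) ↔ Fin (sum (applyUpTo f n))
Σ-Fin↔sum-applyUpTo f zero    = mk↔ₛ′ (λ ()) (λ ()) (λ ()) (λ ())
Σ-Fin↔sum-applyUpTo f (suc n) =
  ↔-trans Σ-Fin↔⊎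
    (↔-trans (↔-id _ ⊎-↔ Σ-Fin↔sum-applyUpTo (f ∘ suc) n) (↔-sym +↔⊎))

Σ-Fin↔sum : ∀ (f : ℕ → ℕ) n → Σ (Fin n) (Fin ∘ f ∘ toℕ) ↔ Fin (sum (map f (upTo n)))
Σ-Fin↔sum f n = subst (λ xs → Σ (Fin n) (Fin ∘ f ∘ toℕ) ↔ Fin (sum xs))
  (sym (map-upTo f n)) (Σ-Fin↔sum-applyUpTo f n)

module _ (S : Setoid c ℓ) (key : Setoid.Carrier S → Fin n) where
  private module S = Setoid S

  -- Keyed by ℕ so that the same fibre can be followed as n grows.
  Fibre : ℕ → Setoid c ℓ
  Fibre a = record
    { Carrier       = Σ S.Carrier (λ x → toℕ (key x) ≡ a)
    ; _≈_           = S._≈_ on proj₁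
    ; isEquivalence = record { refl = S.refl ; sym = S.sym ; trans = S.trans }
    }

  card-fibres : (∀ {x y} → x S.≈ y → key x ≡ key y) → (f : ℕ → ℕ) →
                (∀ i → HasCardinality (Fibre (toℕ i)) (f (toℕ i))) →
                HasCardinality S (sum (map f (upTo n)))
  card-fibres key-cong f I = Inv.trans
    (bijective⇒inverse S (setoid (Σ (Fin n) (Fin ∘ f ∘ toℕ))) to
      (λ {x} {y} x≈y → tag-cong (key-cong x≈y) (x , refl) (y , refl) x≈y)
      (λ {x} {y} → tag-injective (key x) (key y) (x , refl) (y , refl))
      (λ { (i , j) → proj₁ (I.from i j) , to-from i j }))
    (Σ-Fin↔sum f n)
    where
    module I i = Inverse {From = Fibre (toℕ i)} {To = setoid (Fin (f (toℕ i)))} (I i)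
    Tagged = Σ (Fin n) (Fin ∘ f ∘ toℕ)

    to : S.Carrier → Tagged
    to x = key x , I.to (key x) (x , refl)

    -- The keys are variables here so that their equality can be matched with `refl`.
    tag-cong : ∀ {i j} → i ≡ j → (x : Setoid.Carrier (Fibre (toℕ i)))
               (y : Setoid.Carrier (Fibre (toℕ j))) → proj₁ x S.≈ proj₁ y →
               _≡_ {A = Tagged} (i , I.to i x) (j , I.to j y)
    tag-cong {i} refl x y x≈y = cong (i ,_) (I.to-cong i x≈y)

    tag-injective : ∀ i j (x : Setoid.Carrier (Fibre (toℕ i)))
                    (y : Setoid.Carrier (Fibre (toℕ j))) →
                    _≡_ {A = Tagged} (i , I.to i x) (j , I.to j y) → proj₁ x S.≈ proj₁ y
    tag-injective i j x y eq with I.to i x in eqx | I.to j y in eqy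
    tag-injective i j x y refl | _ | _ =
      S.trans (S.sym (I.inverseʳ i (sym eqx))) (I.inverseʳ i (sym eqy))

    to-from : ∀ i j → to (proj₁ (I.from i j)) ≡ (i , j)
    to-from i j = trans
      (tag-cong (toℕ-injective (proj₂ (I.from i j))) _ (I.from i j) S.refl)
      (cong (i ,_) (I.inverseˡ i S.refl))

-- Deleting and inserting an entry of a permutation.

⟨$⟩ʳ-injective : (π : Permutation m n) → ∀ {i j} → π ⟨$⟩ʳ i ≡ π ⟨$⟩ʳ j → i ≡ j
⟨$⟩ʳ-injective π = Injection.injective (↔⇒↣ π)

insert-self : ∀ i j (π : Permutation m n) → insert i j π ⟨$⟩ʳ i ≡ j
insert-self i j π with i ≟ i
... | yes _  = refl
... | no i≢i = contradiction refl i≢i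

-- Applying `punchIn` at the removed value undoes the renumbering, so the comparison becomes one of
-- entries of `π` and `ρ`.
remove-cong : ∀ {i j} (π ρ : Permutation (suc m) (suc n)) → i ≡ j → π ≈ ρ →
              remove i π ≈ remove j ρ
remove-cong {i = i} π ρ refl π≈ρ k = punchIn-injective (π ⟨$⟩ʳ i) _ _ (begin
  punchIn (π ⟨$⟩ʳ i) (remove i π ⟨$⟩ʳ k)  ≡⟨ punchIn-permute π i k ⟨
  π ⟨$⟩ʳ punchIn i k                      ≡⟨ π≈ρ _ ⟩
  ρ ⟨$⟩ʳ punchIn i k                      ≡⟨ punchIn-permute ρ i k ⟩
  punchIn (ρ ⟨$⟩ʳ i) (remove i ρ ⟨$⟩ʳ k)  ≡⟨ cong (λ v → punchIn v (remove i ρ ⟨$⟩ʳ k)) (π≈ρ i) ⟨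
  punchIn (π ⟨$⟩ʳ i) (remove i ρ ⟨$⟩ʳ k)  ∎)
  where open ≡-Reasoning

remove-injective : ∀ {i j} (π ρ : Permutation (suc m) (suc n)) → i ≡ j →
                   π ⟨$⟩ʳ i ≡ ρ ⟨$⟩ʳ j → remove i π ≈ remove j ρ → π ≈ ρ
remove-injective {i = i} π ρ refl πi≡ρi eq k with i ≟ k
... | yes refl = πi≡ρi
... | no i≢k   = begin
  π ⟨$⟩ʳ k                                ≡⟨ cong (π ⟨$⟩ʳ_) (punchIn-punchOut i≢k) ⟨
  π ⟨$⟩ʳ punchIn i k′                     ≡⟨ punchIn-permute π i k′ ⟩
  punchIn (π ⟨$⟩ʳ i) (remove i π ⟨$⟩ʳ k′) ≡⟨ cong₂ punchIn πi≡ρi (eq k′) ⟩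
  punchIn (ρ ⟨$⟩ʳ i) (remove i ρ ⟨$⟩ʳ k′) ≡⟨ punchIn-permute ρ i k′ ⟨
  ρ ⟨$⟩ʳ punchIn i k′                     ≡⟨ cong (ρ ⟨$⟩ʳ_) (punchIn-punchOut i≢k) ⟩
  ρ ⟨$⟩ʳ k                                ∎
  where
  open ≡-Reasoning
  k′ = punchOut i≢k

Sym : ℕ → Setoid 0ℓ 0ℓ
Sym n = record
  { Carrier       = Permutation′ n
  ; _≈_           = _≈_
  ; isEquivalence = record
    { refl  = λ _ → refl
    ; sym   = λ p i → sym (p i)
    ; trans = λ p q i → trans (p i) (q i)
    }
  }

-- The first entry is arbitrary, and deleting it leaves an arbitrary permutation of one letter
-- fewer.
card-Sym : ∀ n → HasCardinality (Sym n) (n !)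
card-Sym zero    = bijective⇒inverse (Sym 0) (setoid (Fin 1)) (λ _ → zero)
  (λ _ → refl) (λ _ ()) (λ { zero → Perm.id , refl })
card-Sym (suc n) = Inv.trans
  (bijective⇒inverse (Sym (suc n)) (setoid (Fin (suc n)) ×ₛ Sym n)
    (λ π → π ⟨$⟩ʳ zero , remove zero π)
    (λ {π} {ρ} π≈ρ → π≈ρ zero , remove-cong π ρ refl π≈ρ)
    (λ {π} {ρ} (eq , eqs) → remove-injective π ρ refl eq eqs)
    (λ (v , π) → insert zero v π , insert-self zero v π , remove-insert zero v π))
  (card-× (Inv.refl (setoid (Fin (suc n)))) (card-Sym n))

-- Avoidance as a condition on neighbouring entries.

-- The case j = 0, excluded in Containsξ, imposes nothing.
AvoidingWord : (Fin (suc n) → ℕ) → Set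
AvoidingWord w = ∀ j k → toℕ k ≡ suc (toℕ j) → w zero < w k → w j ≤ w k

AvoidingWord-resp : {v w : Fin (suc n) → ℕ} → (∀ i → v i ≡ w i) → AvoidingWord v → AvoidingWord w
AvoidingWord-resp eq av j k adj = subst₂ _≤_ (eq j) (eq k) ∘ av j k adj ∘
  subst₂ _<_ (sym (eq zero)) (sym (eq k))

word : Permutation′ n → Fin n → ℕ
word π i = toℕ (π ⟨$⟩ʳ i)

avoidsξ⇒avoidingWord : (π : Permutation′ (suc n)) → Avoidsξ π → AvoidingWord (word π)
avoidsξ⇒avoidingWord π av zero    k adj π₀<πₖ = <⇒≤ π₀<πₖ
avoidsξ⇒avoidingWord π av (suc j) k adj π₀<πₖ =
  ≮⇒≥ λ πₖ<πⱼ → av (zero , suc j , k , refl , s≤s z≤n , adj , π₀<πₖ , πₖ<πⱼ)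

avoidingWord⇒avoidsξ : (π : Permutation′ (suc n)) → AvoidingWord (word π) → Avoidsξ π
avoidingWord⇒avoidsξ π av (zero , j , k , refl , _ , adj , π₀<πₖ , πₖ<πⱼ) =
  ≤⇒≯ (av j k adj π₀<πₖ) πₖ<πⱼ

-- An insertion separates two neighbours only by landing between them, and then the right one
-- directly follows the new position.
punchIn-adjacent : ∀ p (j k : Fin n) → toℕ k ≡ suc (toℕ j) →
                   toℕ (punchIn p k) ≡ suc (toℕ (punchIn p j)) ⊎ toℕ (punchIn p k) ≡ suc (toℕ p)
punchIn-adjacent zero          j       k             adj = inj₁ (cong suc adj)
punchIn-adjacent (suc zero)    zero    (suc zero)    adj = inj₂ refl
punchIn-adjacent (suc (suc p)) zero    (suc zero)    adj = inj₁ refl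
punchIn-adjacent (suc p)       (suc j) (suc k)       adj =
  Sum.map (cong suc) (cong suc) (punchIn-adjacent p j k (ℕ-suc-injective adj))

punchIn-adjacent⁻¹ : ∀ p (j k : Fin n) → toℕ (punchIn p k) ≡ suc (toℕ (punchIn p j)) →
                     toℕ k ≡ suc (toℕ j)
punchIn-adjacent⁻¹ zero          j       k          adj = ℕ-suc-injective adj
punchIn-adjacent⁻¹ (suc zero)    zero    (suc k)    ()
punchIn-adjacent⁻¹ (suc (suc p)) zero    (suc zero) adj = refl
punchIn-adjacent⁻¹ (suc p)       (suc j) (suc k)    adj =
  cong suc (punchIn-adjacent⁻¹ p j k (ℕ-suc-injective adj))

-- Skipping the largest value shifts no other, so deleting the maximum leaves the remaining entries
-- unchanged.
toℕ-punchIn-fromℕ : ∀ (i : Fin n) → toℕ (punchIn (fromℕ n) i) ≡ toℕ i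
toℕ-punchIn-fromℕ zero    = refl
toℕ-punchIn-fromℕ (suc i) = cong suc (toℕ-punchIn-fromℕ i)

-- Insertion sites and cyclic successors.

cyclicPred : Fin (suc n) → Fin (suc n)
cyclicPred zero    = fromℕ _
cyclicPred (suc i) = inject₁ i

cyclicPred-injective : ∀ {i j : Fin (suc n)} → cyclicPred i ≡ cyclicPred j → i ≡ j
cyclicPred-injective {i = zero}  {zero}  eq = refl
cyclicPred-injective {i = zero}  {suc j} eq = contradiction eq fromℕ≢inject₁
cyclicPred-injective {i = suc i} {zero}  eq = contradiction (sym eq) fromℕ≢inject₁
cyclicPred-injective {i = suc i} {suc j} eq = cong suc (inject₁-injective eq)

cyclicPred-surjective : ∀ (i : Fin (suc n)) → ∃[ j ] cyclicPred j ≡ i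
cyclicPred-surjective i with view i
... | ‵fromℕ     = zero , refl
... | ‵inject₁ j = suc j , refl

-- Inserting at position site q puts the new entry right before the entry that
-- was at position q, where position 0 stands for the end of the word.
site : Fin (suc n) → Fin (suc (suc n))
site q = suc (cyclicPred q)

site-injective : ∀ {i j : Fin (suc n)} → site i ≡ site j → i ≡ j
site-injective = cyclicPred-injective ∘ suc-injective

-- Only position 0 is missed: an insertion there would change the first entry.
site-surjective : ∀ (i : Fin (suc (suc n))) → i ≢ zero → ∃[ q ] site q ≡ i
site-surjective zero    i≢0 = contradiction refl i≢0
site-surjective (suc i) _   = let q , eq = cyclicPred-surjective i in q , cong suc eq

punchIn-site-suc : ∀ (i : Fin n) → toℕ (punchIn (site (suc i)) (suc i)) ≡ suc (toℕ (site (suc i)))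
punchIn-site-suc i = cong suc (go i)
  where
  go : ∀ {n} (i : Fin n) → toℕ (punchIn (inject₁ i) i) ≡ suc (toℕ (inject₁ i))
  go zero    = refl
  go (suc i) = cong suc (go i)

successor-site : ∀ q {k : Fin (suc (suc n))} → toℕ k ≡ suc (toℕ (site q)) → k ≡ punchIn (site q) q
-- This site is the last position, so nothing follows it.
successor-site {n} zero {k} adj = contradiction
  (trans adj (cong (λ m → suc (suc m)) (toℕ-fromℕ n))) (<⇒≢ (toℕ<n k))
successor-site (suc i) adj = toℕ-injective (trans adj (sym (punchIn-site-suc i)))

-- Avoiding words with and without their maximum.

module _ (w : Fin (suc (suc n)) → ℕ) where

  -- Any new pair of neighbours surrounds the deleted maximum. Its right member directly followed
  -- the maximum, so it cannot exceed the first entry and is unconstrained.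
  avoidingWord-delete : ∀ p → (∀ i → w (punchIn (suc p) i) < w (suc p)) →
                        AvoidingWord w → AvoidingWord (w ∘ punchIn (suc p))
  avoidingWord-delete p max av j k adj w₀<wₖ with punchIn-adjacent (suc p) j k adj
  ... | inj₁ adj′ = av _ _ adj′ w₀<wₖ
  ... | inj₂ adj′ = contradiction (max k) (≤⇒≯ (av _ _ adj′ w₀<wₖ))

  avoidingWord-successor : ∀ q → (∀ i → w (punchIn (site q) i) < w (site q)) →
                           AvoidingWord w → w (punchIn (site q) q) ≤ w zero
  -- The maximum ends the word, and its cyclic successor is the first entry itself.
  avoidingWord-successor zero    max av = ≤-refl
  avoidingWord-successor (suc i) max av = ≮⇒≥ λ w₀<wₖ →
    <⇒≱ (max (suc i)) (av (site (suc i)) _ (punchIn-site-suc i) w₀<wₖ)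

  -- A pair ending in the maximum ascends, a pair starting with it is unconstrained by `small`, and
  -- any other pair was already adjacent before the insertion.
  avoidingWord-insert : ∀ q → (∀ i → w (punchIn (site q) i) < w (site q)) →
                        AvoidingWord (w ∘ punchIn (site q)) →
                        w (punchIn (site q) q) ≤ w zero → AvoidingWord w
  avoidingWord-insert q max av small j k adj w₀<wₖ with site q ≟ k | site q ≟ j
  ... | yes refl | yes refl = ≤-refl
  ... | yes refl | no p≢j   =
    <⇒≤ (subst (λ i → w i < w (site q)) (punchIn-punchOut p≢j) (max (punchOut p≢j)))
  ... | no _     | yes refl =
    contradiction small (<⇒≱ (subst (λ i → w zero < w i) (successor-site q adj) w₀<wₖ))
  ... | no p≢k   | no p≢j   = subst₂ (λ i i′ → w i ≤ w i′) eqj eqk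
    (av (punchOut p≢j) (punchOut p≢k)
      (punchIn-adjacent⁻¹ (site q) _ _ (trans (cong toℕ eqk) (trans adj (cong (suc ∘ toℕ) (sym eqj)))))
      (subst (λ i → w zero < w i) (sym eqk) w₀<wₖ))
    where
    eqj = punchIn-punchOut p≢j
    eqk = punchIn-punchOut p≢k

module _ (π : Permutation′ (suc n)) (p : Fin (suc n)) (πₚ≡top : π ⟨$⟩ʳ p ≡ fromℕ n) where

  word-punchIn : ∀ i → word π (punchIn p i) ≡ word (remove p π) i
  word-punchIn i = begin
    toℕ (π ⟨$⟩ʳ punchIn p i)                      ≡⟨ cong toℕ (punchIn-permute π p i) ⟩
    toℕ (punchIn (π ⟨$⟩ʳ p) (remove p π ⟨$⟩ʳ i))  ≡⟨ cong (λ v → toℕ (punchIn v (remove p π ⟨$⟩ʳ i))) πₚ≡top ⟩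
    toℕ (punchIn (fromℕ n) (remove p π ⟨$⟩ʳ i))   ≡⟨ toℕ-punchIn-fromℕ (remove p π ⟨$⟩ʳ i) ⟩
    word (remove p π) i                           ∎
    where open ≡-Reasoning

  word-max : ∀ i → word π (punchIn p i) < word π p
  word-max i = subst₂ _<_ (sym (word-punchIn i))
    (sym (trans (cong toℕ πₚ≡top) (toℕ-fromℕ n))) (toℕ<n (remove p π ⟨$⟩ʳ i))

-- Counting avoiders with a fixed first entry.

first : Setoid.Carrier (Symξ (suc n)) → Fin (suc n)
first (π , _) = π ⟨$⟩ʳ zero

-- Indexed by the largest value `n`, not by the length `suc n`, so that the recursion starts at
-- `n = a`.
SymξFrom : ℕ → ℕ → Setoid 0ℓ 0ℓ
SymξFrom a n = Fibre (Symξ (suc n)) first a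

-- No entry exceeds a first entry that is the maximum, so avoidance is vacuous and the rest is an
-- arbitrary permutation.
card-SymξFrom-top : ∀ a → HasCardinality (SymξFrom a a) (a !)
card-SymξFrom-top a = Inv.trans
  (bijective⇒inverse (SymξFrom a a) (Sym a) (λ ((π , _) , _) → remove zero π)
    (λ {((π , _) , _)} {((ρ , _) , _)} → remove-cong π ρ refl)
    (λ {((π , _) , π₀≡a)} {((ρ , _) , ρ₀≡a)} →
      remove-injective π ρ refl (toℕ-injective (trans π₀≡a (sym ρ₀≡a))))
    (λ σ → let π = insert zero (fromℕ a) σ
               π₀≡a : word π zero ≡ a
               π₀≡a = trans (cong toℕ (insert-self zero (fromℕ a) σ)) (toℕ-fromℕ a)
               avoids : AvoidingWord (word π)
               avoids = λ j k adj π₀<πₖ → contradiction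
                 (≤-trans (toℕ≤pred[n] (π ⟨$⟩ʳ k)) (≤-reflexive (sym π₀≡a))) (<⇒≱ π₀<πₖ)
           in ((π , avoidingWord⇒avoidsξ π avoids) , π₀≡a) , remove-insert zero (fromℕ a) σ))
  (card-Sym a)

module _ {a n} (a≤n : a ≤ n) where

  private
    top : Fin (suc (suc n))
    top = fromℕ (suc n)
    module Large = Setoid (SymξFrom a (suc n))
    Small×Slot   = SymξFrom a n ×ₛ setoid (Fin (suc a))
    module Small×Slot = Setoid Small×Slot

  top-site : (((π , _) , _) : Large.Carrier) → ∃[ q ] π ⟨$⟩ʳ site q ≡ top
  top-site ((π , _) , π₀≡a) =
    let q , eq = site-surjective (π ⟨$⟩ˡ top) top≢π₀ in
    q , trans (cong (π ⟨$⟩ʳ_) eq) (inverseʳ π)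
    where
    top≢π₀ : π ⟨$⟩ˡ top ≢ zero
    top≢π₀ eq = <⇒≢ (s≤s a≤n) (begin
      a                              ≡⟨ π₀≡a ⟨
      toℕ (π ⟨$⟩ʳ zero)              ≡⟨ cong (toℕ ∘ (π ⟨$⟩ʳ_)) eq ⟨
      toℕ (π ⟨$⟩ʳ (π ⟨$⟩ˡ top))      ≡⟨ cong toℕ (inverseʳ π) ⟩
      toℕ top                        ≡⟨ toℕ-fromℕ (suc n) ⟩
      suc n                          ∎)
      where open ≡-Reasoning

  -- The slot records the value, not the position, of the cyclic successor of the maximum: the
  -- admissible values are exactly those from 0 to `a`, whatever `σ` is.
  removeTop : Large.Carrier → Small×Slot.Carrier
  removeTop x@((π , av) , π₀≡a) =
    ((σ , avoidingWord⇒avoidsξ σ (AvoidingWord-resp (word-punchIn π (site q) eq)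
             (avoidingWord-delete (word π) (cyclicPred q) (word-max π (site q) eq) avw)))
      , σ₀≡a)
    , fromℕ< (s≤s (subst₂ _≤_ (word-punchIn π (site q) eq q) π₀≡a
               (avoidingWord-successor (word π) q (word-max π (site q) eq) avw)))
    where
    q    = proj₁ (top-site x)
    eq   = proj₂ (top-site x)
    σ    = remove (site q) π
    avw  = avoidsξ⇒avoidingWord π av
    σ₀≡a = trans (sym (word-punchIn π (site q) eq zero)) π₀≡a


  -- `top-site` reads the stored inverse, which the setoid equality does not compare; injectivity of
  -- `π` determines the site instead.
  top-site-unique : (x@((π , _) , _) : Large.Carrier) (ρ : Permutation′ (suc (suc n)))
                    {q : Fin (suc n)} → π ≈ ρ → ρ ⟨$⟩ʳ site q ≡ top → proj₁ (top-site x) ≡ q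
  top-site-unique x@((π , _) , _) ρ π≈ρ eq = site-injective
    (⟨$⟩ʳ-injective π (trans (proj₂ (top-site x)) (sym (trans (π≈ρ _) eq))))

  removeTop-cong : ∀ x y → x Large.≈ y → removeTop x Small×Slot.≈ removeTop y
  removeTop-cong x@((π , _) , _) y@((ρ , _) , _) π≈ρ = σ≈σ′ , toℕ-injective (begin
    toℕ (proj₂ (removeTop x))     ≡⟨ toℕ-fromℕ< _ ⟩
    word (remove (site q) π) q    ≡⟨ cong (word (remove (site q) π)) q≡q′ ⟩
    word (remove (site q) π) q′   ≡⟨ cong toℕ (σ≈σ′ q′) ⟩
    word (remove (site q′) ρ) q′  ≡⟨ toℕ-fromℕ< _ ⟨
    toℕ (proj₂ (removeTop y))     ∎)
    where
    open ≡-Reasoning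
    q    = proj₁ (top-site x)
    q′   = proj₁ (top-site y)
    q≡q′ = top-site-unique x ρ π≈ρ (proj₂ (top-site y))
    σ≈σ′ = remove-cong π ρ (cong site q≡q′) π≈ρ

  removeTop-injective : ∀ x y → removeTop x Small×Slot.≈ removeTop y → x Large.≈ y
  removeTop-injective x@((π , _) , _) y@((ρ , _) , _) (σ≈σ′ , eq) =
    remove-injective π ρ (cong site q≡q′)
      (trans (proj₂ (top-site x)) (sym (proj₂ (top-site y)))) σ≈σ′
    where
    open ≡-Reasoning
    q    = proj₁ (top-site x)
    q′   = proj₁ (top-site y)
    -- The slots give equal successor values, and a permutation takes each value at one position
    -- only.
    q≡q′ = ⟨$⟩ʳ-injective (remove (site q) π) (toℕ-injective (begin
      word (remove (site q) π) q    ≡⟨ toℕ-fromℕ< _ ⟨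
      toℕ (proj₂ (removeTop x))     ≡⟨ cong toℕ eq ⟩
      toℕ (proj₂ (removeTop y))     ≡⟨ toℕ-fromℕ< _ ⟩
      word (remove (site q′) ρ) q′  ≡⟨ cong toℕ (σ≈σ′ q′) ⟨
      word (remove (site q) π) q′   ∎))

  removeTop-surjective : ∀ y → ∃[ x ] removeTop x Small×Slot.≈ y
  removeTop-surjective (((σ , av) , σ₀≡a) , c) =
    x , σ′≈σ , toℕ-injective (begin
      toℕ (proj₂ (removeTop x))      ≡⟨ toℕ-fromℕ< _ ⟩
      word (remove (site q′) π) q′   ≡⟨ cong toℕ (σ′≈σ q′) ⟩
      word σ q′                      ≡⟨ cong (word σ) q′≡q ⟩
      word σ q                       ≡⟨ σq≡c ⟩
      toℕ c                          ∎)
    where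
    open ≡-Reasoning
    -- As `c` is at most `a`, hence at most `n`, it is a value of `σ`; the maximum goes right before
    -- it, or at the end if it is the first entry.
    v    = inject≤ c (s≤s a≤n)
    q    = σ ⟨$⟩ˡ v
    π    = insert (site q) top σ
    πₚ≡top = insert-self (site q) top σ
    σ≗π : ∀ i → word σ i ≡ word π (punchIn (site q) i)
    σ≗π i = sym (trans (word-punchIn π (site q) πₚ≡top i) (cong toℕ (remove-insert (site q) top σ i)))
    σq≡c : word σ q ≡ toℕ c
    σq≡c = trans (cong toℕ (inverseʳ σ)) (toℕ-inject≤ c (s≤s a≤n))
    π₀≡a = trans (sym (σ≗π zero)) σ₀≡a
    avoids : AvoidingWord (word π)
    avoids = avoidingWord-insert (word π) q (word-max π (site q) πₚ≡top)
      (AvoidingWord-resp σ≗π (avoidsξ⇒avoidingWord σ av))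
      (subst₂ _≤_ (trans (sym σq≡c) (σ≗π q)) (sym π₀≡a) (toℕ≤pred[n] c))
    x : Large.Carrier
    x = (π , avoidingWord⇒avoidsξ π avoids) , π₀≡a
    q′   = proj₁ (top-site x)
    q′≡q : q′ ≡ q
    q′≡q = top-site-unique x π (λ _ → refl) πₚ≡top
    σ′≈σ : remove (site q′) π ≈ σ
    σ′≈σ i = trans (remove-cong π π (cong site q′≡q) (λ _ → refl) i) (remove-insert (site q) top σ i)

  card-SymξFrom-suc : ∀ {N} → HasCardinality (SymξFrom a n) N →
                      HasCardinality (SymξFrom a (suc n)) (N * suc a)
  card-SymξFrom-suc I = Inv.trans
    (bijective⇒inverse (SymξFrom a (suc n)) Small×Slot
      removeTop (λ {x} {y} → removeTop-cong x y) (λ {x} {y} → removeTop-injective x y)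
      removeTop-surjective)
    (card-× I (Inv.refl _))

-- Here `m` counts the values above `a`, each contributing a factor `suc a` when it is inserted as
-- the new maximum.
card-SymξFrom-+ : ∀ a m → HasCardinality (SymξFrom a (m + a)) (a ! * suc a ^ m)
card-SymξFrom-+ a zero    = subst (HasCardinality (SymξFrom a a)) (sym (*-identityʳ (a !)))
  (card-SymξFrom-top a)
card-SymξFrom-+ a (suc m) = subst (HasCardinality (SymξFrom a (suc m + a)))
  (trans (*-assoc (a !) _ (suc a)) (cong (a ! *_) (*-comm (suc a ^ m) (suc a))))
  (card-SymξFrom-suc (m≤n+m a m) (card-SymξFrom-+ a m))

card-SymξFrom : ∀ {a n} → a ≤ n →
                HasCardinality (SymξFrom a n) (a ! * (a + 1) ^ (suc n ∸ a ∸ 1))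
card-SymξFrom {a} {n} a≤n
  -- The exponent becomes `suc n ∸ (a + 1)`, then `suc n ∸ suc a`, which computes to `n ∸ a`.
  rewrite ∸-+-assoc (suc n) a 1 | +-comm a 1 =
  subst (λ k → HasCardinality (SymξFrom a k) (a ! * suc a ^ (n ∸ a))) (m∸n+n≡m a≤n)
    (card-SymξFrom-+ a (n ∸ a))

theorem5 : (n : ℕ) → n ≥ 1 →
    HasCardinality (Symξ n) (sum (map (λ t → t ! * (t + 1) ^ (n ∸ t ∸ 1)) (upTo n)))
theorem5 (suc n) _ = card-fibres (Symξ (suc n)) first
  (λ π≈ρ → π≈ρ zero)
  (λ t → t ! * (t + 1) ^ (suc n ∸ t ∸ 1))
  (λ i → card-SymξFrom (toℕ≤pred[n] i))
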